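{- Let $P$ be a rooted forest on $[n]$ whose labeling is natural, let $x_1,\dots,x_n$ be strictly positive reals, and let $x_{\preceq i}=\sum_{j\preceq i}x_j$. Set $$Z_P=\prod_{i=1}^n\frac{x_{\preceq i}}{x_1+\cdots+x_i},\qquad w(\pi)=\prod_{i=1}^{n}\frac{x_1+\cdots+x_i}{x_{\pi_1}+\cdots+x_{\pi_i}}\quad(\pi\in\mathcal{L}(P)).$$ Then $Z_P$ is the partition function of the promotion graph, i.e. $\sum_{\pi\in\mathcal{L}(P)}Z_P\,w(\pi)=1$.
   Context: A rooted tree is a connected finite poset in which each element is covered by at most one element (has at most one successor); a rooted forest is a disjoint union of rooted trees. Natural labeling: $i\prec j$ implies $i<j$. $\mathcal{L}(P)=\{\pi\in S_n : i\prec j \Rightarrow \pi^{ -1}_i<\pi^{ -1}_j\}$, in one-line notation $\pi=\pi_1\cdots\pi_n$. (The function $w$ is the stationary state of the promotion graph Markov chain normalized by $w(e)=1$.) -}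

module Defs where

open import Algebra.Apartness.Bundles using (HeytingField)
open import Algebra.Bundles using (CommutativeRing)
import Algebra.Apartness.Properties.HeytingCommutativeRing as HCRProperties
import Algebra.Properties.CommutativeMonoid.Sum as Sum
open import Data.Bool.Base using (if_then_else_)
open import Data.Fin.Base as Fin using (Fin; zero; suc; fromℕ; punchIn)
import Data.Fin.Properties as Finₚ
open import Data.Fin.Permutation as Perm
  using (Permutation′; _⟨$⟩ʳ_; _⟨$⟩ˡ_; insert; remove)
open import Data.List.Base as List using (List; []; _∷_; filter; cartesianProductWith)
import Data.List.Membership.Setoid as SetoidMembership
import Data.List.Membership.Setoid.Properties as SetoidMembershipₚ
open import Data.List.Membership.Propositional.Properties using (∈-allFin)
open import Data.List.Relation.Unary.All as All using ()
open import Data.List.Relation.Unary.AllPairs as AllPairs using ()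
open import Data.List.Relation.Unary.Any using (here)
import Data.List.Relation.Unary.Unique.Setoid as SetoidUnique
import Data.List.Relation.Unary.Unique.Setoid.Properties as SetoidUniqueₚ
open import Data.List.Relation.Unary.Unique.Propositional.Properties using (allFin⁺)
open import Data.Nat.Base as ℕ using (ℕ; zero; suc)
open import Data.Product.Base using (∃; _×_; _,_; proj₁; proj₂)
import Data.Rational as ℚ
import Data.Rational.Properties as ℚₚ
open import Data.Sum.Base using (_⊎_; inj₁; inj₂)
open import Function.Base using (_∘_)
open import Function.Bundles using (_⇔_; mk⇔; Equivalence)
open import Level using (Level; _⊔_; 0ℓ) renaming (suc to ℓsuc)
open import Relation.Binary.Bundles using (Poset; Setoid)
open import Relation.Binary.Core using (Rel)
open import Relation.Binary.Definitions using (tri<; tri≈; tri>)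
open import Relation.Binary.Construct.Closure.Equivalence using (EqClosure)
import Relation.Binary.Construct.NonStrictToStrict as ToStrict
import Relation.Binary.Construct.On as On
import Relation.Binary.Properties.Poset as PosetProperties
open import Relation.Binary.PropositionalEquality as ≡ using (_≡_; refl; setoid)
open import Relation.Binary.Structures using (IsDecPartialOrder; IsStrictPartialOrder)
open import Relation.Nullary using (¬_; Dec; does; yes; no; contradiction)
open import Relation.Nullary.Decidable using (_→-dec_; dec-yes)
open import Relation.Unary using (Pred; Decidable)

-- Stands in for the real numbers, which the standard library lacks.  Nothing
-- here requires the order or the equality to be decidable, so that both the
-- classical and the constructive reals satisfy the axioms.
record OrderedField c ℓ₁ ℓ₂ ℓ₃ : Set (ℓsuc (c ⊔ ℓ₁ ⊔ ℓ₂ ⊔ ℓ₃)) where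
  infix 4 _<_
  field
    heytingField : HeytingField c ℓ₁ ℓ₂

  open HeytingField heytingField public

  field
    _<_                    : Rel Carrier ℓ₃
    <-isStrictPartialOrder : IsStrictPartialOrder _≈_ _<_
    #⇔<⊎>                  : ∀ x y → x # y ⇔ (x < y ⊎ y < x)
    +-monoˡ-<              : ∀ z {x y} → x < y → x + z < y + z
    *-pos                  : ∀ {x y} → 0# < x → 0# < y → 0# < x * y

  commutativeRing : CommutativeRing c ℓ₁
  commutativeRing = record { isCommutativeRing = isCommutativeRing }

ℚ-orderedField : OrderedField 0ℓ 0ℓ 0ℓ 0ℓ
ℚ-orderedField = record
  { heytingField           = ℚₚ.heytingField
  ; _<_                    = ℚ._<_
  ; <-isStrictPartialOrder = ℚₚ.<-isStrictPartialOrder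
  ; #⇔<⊎>                  = λ p q → mk⇔ (≢⇒<⊎> p q) <⊎>⇒≢
  ; +-monoˡ-<              = ℚₚ.+-monoˡ-<
  ; *-pos                  = λ {p} {q} p>0 q>0 →
      ℚₚ.positive⁻¹ (p ℚ.* q)
        {{ℚₚ.pos*pos⇒pos p {{ℚ.positive p>0}} q {{ℚ.positive q>0}}}}
  }
  where
  ≢⇒<⊎> : ∀ p q → ¬ p ≡ q → p ℚ.< q ⊎ q ℚ.< p
  ≢⇒<⊎> p q p≢q with ℚₚ.<-cmp p q
  ... | tri< p<q _ _ = inj₁ p<q
  ... | tri≈ _ p≡q _ = contradiction p≡q p≢q
  ... | tri> _ _ q<p = inj₂ q<p

  <⊎>⇒≢ : ∀ {p q} → p ℚ.< q ⊎ q ℚ.< p → ¬ p ≡ q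
  <⊎>⇒≢ (inj₁ p<q) p≡q = ℚₚ.<-irrefl p≡q p<q
  <⊎>⇒≢ (inj₂ q<p) p≡q = ℚₚ.<-irrefl (≡.sym p≡q) q<p

module FieldOperations {c ℓ₁ ℓ₂ ℓ₃} (F : OrderedField c ℓ₁ ℓ₂ ℓ₃) where
  open OrderedField F hiding (zero; refl)
  private
    module <SPO = IsStrictPartialOrder <-isStrictPartialOrder
    module Additive       = Sum (CommutativeRing.+-commutativeMonoid commutativeRing)
    module Multiplicative = Sum (CommutativeRing.*-commutativeMonoid commutativeRing)

  ∑ ∏ : ∀ {n} → (Fin n → Carrier) → Carrier
  ∑ = Additive.sum
  ∏ = Multiplicative.sum

  ∑ᴸ : List Carrier → Carrier
  ∑ᴸ = List.foldr _+_ 0#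

  ∑-over : ∀ {n p} {P : Pred (Fin n) p} → Decidable P → (Fin n → Carrier) → Carrier
  ∑-over P? x = ∑ λ j → if does (P? j) then x j else 0#

  -- The multiplicative inverse of b is determined up to _≈_, so the quotient
  -- does not depend on the proof of positivity.
  _/_[_] : ∀ (a b : Carrier) → 0# < b → Carrier
  a / b [ b>0 ] =
    a * proj₁ (#⇒invertible (Equivalence.from (#⇔<⊎> b 0#) (inj₂ b>0)))

  /-correct : ∀ a b (b>0 : 0# < b) → (a / b [ b>0 ]) * b ≈ a
  /-correct a b b>0
    with b⁻¹ , b⁻¹*[b-0]≈1 , _ ← #⇒invertible (Equivalence.from (#⇔<⊎> b 0#) (inj₂ b>0))
    = trans (*-assoc a b⁻¹ b)
     (trans (*-congˡ (trans (*-congˡ (sym (HCR.x-0≈x b))) b⁻¹*[b-0]≈1))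
            (*-identityʳ a))
    where module HCR = HCRProperties (HeytingField.heytingCommutativeRing heytingField)

  private
    Nonneg : Carrier → Set (ℓ₁ ⊔ ℓ₃)
    Nonneg a = 0# ≈ a ⊎ 0# < a

    +-pos-nonneg : ∀ {a b} → 0# < a → Nonneg b → 0# < a + b
    +-pos-nonneg {a} {b} a>0 (inj₁ 0≈b) =
      <SPO.<-respʳ-≈ (trans (sym (+-identityʳ a)) (+-congˡ 0≈b)) a>0
    +-pos-nonneg {a} {b} a>0 (inj₂ b>0) =
      <SPO.trans b>0 (<SPO.<-respˡ-≈ (+-identityˡ b) (+-monoˡ-< b a>0))

    +-nonneg-pos : ∀ {a b} → Nonneg a → 0# < b → 0# < a + b
    +-nonneg-pos a≥0 b>0 = <SPO.<-respʳ-≈ (+-comm _ _) (+-pos-nonneg b>0 a≥0)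

    +-nonneg : ∀ {a b} → Nonneg a → Nonneg b → Nonneg (a + b)
    +-nonneg (inj₂ a>0) b≥0        = inj₂ (+-pos-nonneg a>0 b≥0)
    +-nonneg a≥0        (inj₂ b>0) = inj₂ (+-nonneg-pos a≥0 b>0)
    +-nonneg (inj₁ 0≈a) (inj₁ 0≈b) =
      inj₁ (trans (sym (+-identityˡ 0#)) (+-cong 0≈a 0≈b))

    ∑-nonneg : ∀ {n} (y : Fin n → Carrier) → (∀ j → Nonneg (y j)) → Nonneg (∑ y)
    ∑-nonneg {zero}  y y≥0 = inj₁ (OrderedField.refl F)
    ∑-nonneg {suc n} y y≥0 = +-nonneg (y≥0 zero) (∑-nonneg (y ∘ suc) (y≥0 ∘ suc))

    ∑-pos : ∀ {n} (y : Fin n → Carrier) → (∀ j → Nonneg (y j)) →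
            ∀ i → 0# < y i → 0# < ∑ y
    ∑-pos y y≥0 zero    yᵢ>0 = +-pos-nonneg yᵢ>0 (∑-nonneg (y ∘ suc) (y≥0 ∘ suc))
    ∑-pos y y≥0 (suc i) yᵢ>0 = +-nonneg-pos (y≥0 zero) (∑-pos (y ∘ suc) (y≥0 ∘ suc) i yᵢ>0)

  ∑-over-pos : ∀ {n p} {P : Pred (Fin n) p} (P? : Decidable P) {x : Fin n → Carrier} →
               (∀ j → 0# < x j) → ∀ {i} → P i → 0# < ∑-over P? x
  ∑-over-pos P? {x} x>0 {i} Pi = ∑-pos _ terms≥0 i termᵢ>0
    where
    terms≥0 : ∀ j → Nonneg (if does (P? j) then x j else 0#)
    terms≥0 j with P? j
    ... | yes _ = inj₂ (x>0 j)
    ... | no  _ = inj₁ (OrderedField.refl F)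

    termᵢ>0 : 0# < (if does (P? i) then x i else 0#)
    termᵢ>0 rewrite proj₂ (dec-yes (P? i) Pi) = x>0 i

module _ {a ℓ₁ ℓ₂} (P : Poset a ℓ₁ ℓ₂) where
  open Poset P
  open PosetProperties P using (_<_)

  _isCoveredBy_ : Rel Carrier _
  x isCoveredBy y = x < y × ∀ z → ¬ (x < z × z < y)

  record IsRootedTree : Set (a ⊔ ℓ₁ ⊔ ℓ₂) where
    field
      element     : Carrier
      connected   : ∀ x y → EqClosure _≤_ x y
      uniqueCover : ∀ {x y z} → x isCoveredBy y → x isCoveredBy z → y ≈ z

-- P is the disjoint union of the fibres of `component`, with elements of
-- distinct fibres incomparable, and each fibre a rooted tree under the
-- induced order.
record IsRootedForest {a ℓ₁ ℓ₂} (P : Poset a ℓ₁ ℓ₂) : Set (a ⊔ ℓ₁ ⊔ ℓ₂) where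
  open Poset P
  field
    trees           : ℕ
    component       : Carrier → Fin trees
    ≤⇒sameComponent : ∀ {x y} → x ≤ y → component x ≡ component y
    isRootedTree    : ∀ t →
      IsRootedTree (On.poset P (proj₁ {B = λ x → component x ≡ t}))

-- A permutation of n + 1 letters is determined by its last letter and by the
-- standardization of the remaining word.
permutations : ∀ n → List (Permutation′ n)
permutations zero    = Perm.id ∷ []
permutations (suc n) =
  cartesianProductWith (insert (fromℕ n)) (List.allFin (suc n)) (permutations n)

permutationSetoid : ℕ → Setoid 0ℓ 0ℓ
permutationSetoid n = record
  { Carrier       = Permutation′ n
  ; _≈_           = Perm._≈_
  ; isEquivalence = record
    { refl  = λ _ → refl
    ; sym   = λ π≈ρ i → ≡.sym (π≈ρ i)
    ; trans = λ π≈ρ ρ≈σ i → ≡.trans (π≈ρ i) (ρ≈σ i)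
    }
  }

private
  insert-at : ∀ {n} i j (π : Permutation′ n) → insert i j π ⟨$⟩ʳ i ≡ j
  insert-at i j π rewrite proj₂ (dec-yes (i Finₚ.≟ i) refl) = refl

  insert-cong : ∀ {n} i {j k} {π ρ : Permutation′ n} → j ≡ k → π Perm.≈ ρ →
                insert i j π Perm.≈ insert i k ρ
  insert-cong i {j} refl π≈ρ l with i Finₚ.≟ l
  ... | yes _ = refl
  ... | no  _ = ≡.cong (punchIn j) (π≈ρ _)

  insert-injective : ∀ {n} i {j k} {π ρ : Permutation′ n} →
                     insert i j π Perm.≈ insert i k ρ → j ≡ k × π Perm.≈ ρ
  insert-injective i {j} {k} {π} {ρ} eq
    with refl ← ≡.trans (≡.sym (insert-at i j π)) (≡.trans (eq i) (insert-at i k ρ))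
    = refl , λ l → Finₚ.punchIn-injective j _ _
        (≡.trans (≡.sym (Perm.insert-punchIn i j π l))
        (≡.trans (eq (punchIn i l)) (Perm.insert-punchIn i j ρ l)))

permutations-complete : ∀ {n} (π : Permutation′ n) →
  SetoidMembership._∈_ (permutationSetoid n) π (permutations n)
permutations-complete {zero}  π = here λ ()
permutations-complete {suc n} π =
  SetoidMembershipₚ.∈-resp-≈ (permutationSetoid (suc n))
    {x = insert (fromℕ n) (π ⟨$⟩ʳ fromℕ n) (remove (fromℕ n) π)} {y = π}
    (Perm.insert-remove (fromℕ n) π)
    (SetoidMembershipₚ.∈-cartesianProductWith⁺
      (setoid _) (permutationSetoid n) (permutationSetoid (suc n))
      (λ {j} {k} {π} {ρ} → insert-cong (fromℕ n) {j} {k} {π} {ρ})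
      (∈-allFin (π ⟨$⟩ʳ fromℕ n))
      (permutations-complete (remove (fromℕ n) π)))

permutations-unique : ∀ n →
  SetoidUnique.Unique (permutationSetoid n) (permutations n)
permutations-unique zero    = All.[] AllPairs.∷ AllPairs.[]
permutations-unique (suc n) =
  SetoidUniqueₚ.cartesianProductWith⁺
    (setoid _) (permutationSetoid n) (permutationSetoid (suc n))
    (insert (fromℕ n))
    (λ {j} {k} {π} {ρ} → insert-injective (fromℕ n) {j} {k} {π} {ρ})
    (allFin⁺ (suc n)) (permutations-unique n)

record PosetOn (n : ℕ) ℓ : Set (ℓsuc ℓ) where
  infix 4 _≼_ _≺_ _≺?_
  field
    _≼_               : Rel (Fin n) ℓ
    isDecPartialOrder : IsDecPartialOrder _≡_ _≼_

  open IsDecPartialOrder isDecPartialOrder public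
    using (isPartialOrder) renaming (_≤?_ to _≼?_)

  poset : Poset 0ℓ 0ℓ ℓ
  poset = record { isPartialOrder = isPartialOrder }

  _≺_ : Rel (Fin n) ℓ
  _≺_ = ToStrict._<_ _≡_ _≼_

  _≺?_ : ∀ i j → Dec (i ≺ j)
  _≺?_ = ToStrict.<-decidable _≡_ _≼_ Finₚ._≟_ _≼?_

  IsNatural : Set ℓ
  IsNatural = ∀ i j → i ≺ j → i Fin.< j

  IsLinearExtension : Permutation′ n → Set ℓ
  IsLinearExtension π = ∀ i j → i ≺ j → (π ⟨$⟩ˡ i) Fin.< (π ⟨$⟩ˡ j)

  isLinearExtension? : ∀ π → Dec (IsLinearExtension π)
  isLinearExtension? π = Finₚ.all? λ i → Finₚ.all? λ j →
    (i ≺? j) →-dec ((π ⟨$⟩ˡ i) Finₚ.<? (π ⟨$⟩ˡ j))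

  linearExtensions : List (Permutation′ n)
  linearExtensions = filter isLinearExtension? (permutations n)

module Weights {c ℓ₁ ℓ₂ ℓ₃} (F : OrderedField c ℓ₁ ℓ₂ ℓ₃) where
  open OrderedField F hiding (zero; refl)
  open FieldOperations F

  prefixSum : ∀ {n} → (Fin n → Carrier) → Fin n → Carrier
  prefixSum y i = ∑-over (Finₚ._≤? i) y

  prefixSum-pos : ∀ {n} {y : Fin n → Carrier} → (∀ j → 0# < y j) →
                  ∀ i → 0# < prefixSum y i
  prefixSum-pos y>0 i = ∑-over-pos (Finₚ._≤? i) y>0 (Finₚ.≤-refl {x = i})

  module _ {n} (x : Fin n → Carrier) (x>0 : ∀ i → 0# < x i) where

    Z : ∀ {ℓ} → PosetOn n ℓ → Carrier
    Z P = ∏ λ i → ∑-over (_≼? i) x / prefixSum x i [ prefixSum-pos x>0 i ]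
      where open PosetOn P

    w : Permutation′ n → Carrier
    w π = ∏ λ i →
      prefixSum x i / prefixSum (x ∘ (π ⟨$⟩ʳ_)) i [ prefixSum-pos (x>0 ∘ (π ⟨$⟩ʳ_)) i ]

{-# OPTIONS --safe #-}

-- The denominators x₁ + ⋯ + xᵢ of Z cancel against w, which leaves the weighted
-- hook formula ∑_{π ∈ L(P)} ∏ᵢ 1 / (x_{π₁} + ⋯ + x_{πᵢ}) = ∏ᵢ 1 / x_{≼ i}, proved by
-- induction on n.  The last letter j of a linear extension is maximal and contributes
-- 1 / X, where X is the sum of all the x's, and the rest of the word is a linear
-- extension of P ∖ j.  Deleting a maximal j changes no other hook, so the letter j
-- accounts for x_{≼ j} / X times the right-hand side.  In a rooted forest the down-sets
-- of the maximal elements partition the ground set, so these fractions add up to 1.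

module Submission where

open import Defs
open import Algebra.Bundles using (CommutativeRing)
import Algebra.Properties.CommutativeMonoid.Sum as Sum
import Algebra.Properties.CommutativeSemigroup as CommutativeSemigroupProperties
import Algebra.Properties.Semiring.Sum as SemiringSum
open import Data.Bool.Base using (Bool; true; false; if_then_else_)
open import Data.Fin.Base as Fin using (Fin; zero; suc; fromℕ; punchIn; punchOut)
open import Data.Fin.Induction using (po-noetherian; po-wellFounded)
open import Data.Fin.Permutation
  using (Permutation′; _⟨$⟩ʳ_; _⟨$⟩ˡ_; insert; inverseˡ; insert-punchIn)
import Data.Fin.Properties as Finₚ
open import Data.List.Base using ([]; _∷_; _++_; map; filter; cartesianProductWith; tabulate)
open import Data.List.Properties using (map-∘)
open import Data.Nat.Base using (ℕ; zero; suc)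
import Data.Nat.Properties as ℕₚ
open import Data.Product.Base using (∃; _×_; _,_; proj₁)
open import Data.Sum.Base using (_⊎_; inj₁; inj₂)
open import Function.Base using (_∘_; flip)
open import Function.Bundles using (_⇔_; mk⇔)
open import Induction.WellFounded using (Acc; acc)
open import Level using (Level)
open import Relation.Binary.Bundles using (Poset)
open import Relation.Binary.PropositionalEquality as ≡ using (_≡_; refl; _≢_)
open import Relation.Binary.Structures using (IsStrictPartialOrder)
open import Relation.Nullary using (¬_; Dec; does; yes; no; contradiction)
open import Relation.Nullary.Decidable using (does-⇔; dec-true; dec-false; ¬?; _×-dec_)
open import Relation.Unary using (Pred; Decidable)

private
  variable
    a ℓ : Level
    n : ℕ

-- Up-sets and maximal elements of a rooted forest.

module _ (P : PosetOn n ℓ) where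
  open PosetOn P
  open Poset poset using () renaming (refl to ≼-refl; trans to ≼-trans; antisym to ≼-antisym)

  -- The form in which the forest hypothesis enters the induction: it restricts directly to a subset
  -- of the ground set, whereas covers and components would have to be recomputed.
  UpSetsAreChains : Set ℓ
  UpSetsAreChains = ∀ {i j k} → i ≼ j → i ≼ k → j ≼ k ⊎ k ≼ j

  IsMaximal : Fin n → Set ℓ
  IsMaximal j = ∀ k → ¬ j ≺ k

  isMaximal? : Decidable IsMaximal
  isMaximal? j = Finₚ.all? λ k → ¬? (j ≺? k)

  ≺-noetherian : ∀ i → Acc (flip _≺_) i
  ≺-noetherian = po-noetherian isPartialOrder

  ≺-wellFounded : ∀ i → Acc _≺_ i
  ≺-wellFounded = po-wellFounded isPartialOrder

  -- Well-founded descent on `j`: an element strictly between `i` and `j` replaces `j`, and once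
  -- there is none, the current `j` covers `i`.
  coverBelow : ∀ {i j} → i ≺ j → ∃ λ c → _isCoveredBy_ poset i c × c ≼ j
  coverBelow {i} {j} = search (≺-wellFounded j)
    where
    search : ∀ {j} → Acc _≺_ j → i ≺ j → ∃ λ c → _isCoveredBy_ poset i c × c ≼ j
    search {j} (acc rs) i≺j with Finₚ.any? (λ z → (i ≺? z) ×-dec (z ≺? j))
    ... | no  ∄z              = j , (i≺j , λ z i≺z≺j → ∄z (z , i≺z≺j)) , ≼-refl
    ... | yes (z , i≺z , z≺j) with c , i⋖c , c≼z ← search (rs z≺j) i≺z
                              = c , i⋖c , ≼-trans c≼z (proj₁ z≺j)

  -- Noetherian induction on `i`: if `i` is strictly below both `j` and `k`, then both lie above the
  -- unique cover of `i`.
  rootedForest⇒upSetsAreChains : IsRootedForest poset → UpSetsAreChains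
  rootedForest⇒upSetsAreChains forest {i} = compare (≺-noetherian i)
    where
    open IsRootedForest forest

    cover-unique : ∀ {i c d} → _isCoveredBy_ poset i c → _isCoveredBy_ poset i d → c ≡ d
    cover-unique {i} {c} {d} (i≺c , i⋖c) (i≺d , i⋖d) =
      -- Both covers share the component of `i`, and a cover in `P` remains one in that fibre, where
      -- fewer elements could lie in between.
      IsRootedTree.uniqueCover (isRootedTree (component i))
        {i , refl}
        {c , ≡.sym (≤⇒sameComponent (proj₁ i≺c))}
        {d , ≡.sym (≤⇒sameComponent (proj₁ i≺d))}
        (i≺c , λ z → i⋖c (proj₁ z))
        (i≺d , λ z → i⋖d (proj₁ z))

    compare : ∀ {i} → Acc (flip _≺_) i → ∀ {j k} → i ≼ j → i ≼ k → j ≼ k ⊎ k ≼ j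
    compare {i} (acc rs) {j} {k} i≼j i≼k with i Finₚ.≟ j | i Finₚ.≟ k
    ... | yes refl | _        = inj₁ i≼k
    ... | no  _    | yes refl = inj₂ i≼j
    ... | no  i≢j  | no  i≢k
      with c , i⋖c , c≼j ← coverBelow (i≼j , i≢j)
         | d , i⋖d , d≼k ← coverBelow (i≼k , i≢k)
      with refl ← cover-unique i⋖c i⋖d
      = compare (rs (proj₁ i⋖c)) c≼j d≼k

  maximalAbove : ∀ i → ∃ λ r → i ≼ r × IsMaximal r
  maximalAbove i = climb (≺-noetherian i)
    where
    climb : ∀ {i} → Acc (flip _≺_) i → ∃ λ r → i ≼ r × IsMaximal r
    climb {i} (acc rs) with Finₚ.any? (i ≺?_)
    ... | no  ∄k        = i , ≼-refl , λ k i≺k → ∄k (k , i≺k)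
    ... | yes (k , i≺k) with r , k≼r , r-max ← climb (rs i≺k)
                        = r , ≼-trans (proj₁ i≺k) k≼r , r-max

  -- Two maximal elements above `i` are comparable, hence equal. So distinct maximal elements have
  -- disjoint down-sets.
  maximalAbove-unique : UpSetsAreChains → ∀ {i r s} →
                        i ≼ r → IsMaximal r → i ≼ s → IsMaximal s → r ≡ s
  maximalAbove-unique chains {i} {r} {s} i≼r r-max i≼s s-max with r Finₚ.≟ s
  ... | yes r≡s = r≡s
  ... | no  r≢s with chains i≼r i≼s
  ...   | inj₁ r≼s = contradiction (r≼s , r≢s) (r-max s)
  ...   | inj₂ s≼r = contradiction (s≼r , r≢s ∘ ≡.sym) (s-max r)

-- Deleting one element from a poset.

infixl 6 _∖_

-- The order is pulled back along `punchIn j`, the same renumbering of letters that `insert` uses.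
_∖_ : PosetOn (suc n) ℓ → Fin (suc n) → PosetOn n ℓ
P ∖ j = record
  { _≼_               = λ k l → punchIn j k ≼ punchIn j l
  ; isDecPartialOrder = record
    { isPartialOrder = record
      { isPreorder = record
        { isEquivalence = ≡.isEquivalence
        ; reflexive     = λ { refl → ≼-refl }
        ; trans         = ≼-trans
        }
      ; antisym = λ k≼l l≼k → Finₚ.punchIn-injective j _ _ (≼-antisym k≼l l≼k)
      }
    ; _≟_  = Finₚ._≟_
    ; _≤?_ = λ k l → punchIn j k ≼? punchIn j l
    }
  }
  where
  open PosetOn P
  open Poset poset using () renaming (refl to ≼-refl; trans to ≼-trans; antisym to ≼-antisym)

-- Positions and letters under `punchIn` and `insert`.

punchIn-mono-< : ∀ (i : Fin (suc n)) {j k} → j Fin.< k → punchIn i j Fin.< punchIn i k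
punchIn-mono-< i j<k = ℕₚ.≰⇒> (ℕₚ.<⇒≱ j<k ∘ Finₚ.punchIn-cancel-≤ i _ _)

punchIn-cancel-< : ∀ (i : Fin (suc n)) {j k} → punchIn i j Fin.< punchIn i k → j Fin.< k
punchIn-cancel-< i j<k = ℕₚ.≰⇒> (ℕₚ.<⇒≱ j<k ∘ Finₚ.punchIn-mono-≤ i _ _)

fromℕ≮ : ∀ {i : Fin (suc n)} → ¬ fromℕ n Fin.< i
fromℕ≮ {i = i} n<i = ℕₚ.<⇒≱ n<i (Finₚ.≤fromℕ i)

punchIn<fromℕ : ∀ (i : Fin n) → punchIn (fromℕ n) i Fin.< fromℕ n
punchIn<fromℕ {n} i = Finₚ.≤∧≢⇒< (Finₚ.≤fromℕ _) (Finₚ.punchInᵢ≢i (fromℕ n) i)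

-- Separates the deleted letter `j` from the letters of `P ∖ j`, refining the index so that the
-- lemmas on `insert` apply.
data PunchInView (j : Fin (suc n)) : Fin (suc n) → Set where
  hole    : PunchInView j j
  punched : ∀ k → PunchInView j (punchIn j k)

punchInView : ∀ (j k : Fin (suc n)) → PunchInView j k
punchInView j k with j Finₚ.≟ k
... | yes refl = hole
... | no  j≢k  = ≡.subst (PunchInView j) (Finₚ.punchIn-punchOut j≢k) (punched (punchOut j≢k))

insert-at : ∀ i j (π : Permutation′ n) → insert i j π ⟨$⟩ʳ i ≡ j
insert-at i j π with i Finₚ.≟ i
... | yes _   = refl
... | no  i≢i = contradiction refl i≢i

insert⁻¹-at : ∀ i j (π : Permutation′ n) → insert i j π ⟨$⟩ˡ j ≡ i
insert⁻¹-at i j π = ≡.trans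
  (≡.cong (insert i j π ⟨$⟩ˡ_) (≡.sym (insert-at i j π)))
  (inverseˡ (insert i j π))

insert⁻¹-punchIn : ∀ i j (π : Permutation′ n) k →
                   insert i j π ⟨$⟩ˡ punchIn j k ≡ punchIn i (π ⟨$⟩ˡ k)
insert⁻¹-punchIn i j π k with j Finₚ.≟ punchIn j k
... | yes j≡ = contradiction (≡.sym j≡) (Finₚ.punchInᵢ≢i j k)
... | no  j≢ = ≡.cong (punchIn i ∘ (π ⟨$⟩ˡ_))
                 -- `punchOut` carries an inequality proof, which is first exchanged for the one in
                 -- `punchOut-punchIn`.
                 (≡.trans (Finₚ.punchOut-cong j refl) (Finₚ.punchOut-punchIn j))

-- The last letter of a linear extension.

module _ (P : PosetOn (suc n) ℓ) where
  open PosetOn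

  private
    ∖-≺⁺ : ∀ j {k l} → _≺_ P (punchIn j k) (punchIn j l) → _≺_ (P ∖ j) k l
    ∖-≺⁺ j (k≼l , k≢l) = k≼l , k≢l ∘ ≡.cong (punchIn j)

    ∖-≺⁻ : ∀ j {k l} → _≺_ (P ∖ j) k l → _≺_ P (punchIn j k) (punchIn j l)
    ∖-≺⁻ j (k≼l , k≢l) = k≼l , k≢l ∘ Finₚ.punchIn-injective j _ _

  -- Position `fromℕ n` holds `j`, and an element strictly above `j` would need a later position.
  insert-linearExtension⇒maximal : ∀ {j π} →
    IsLinearExtension P (insert (fromℕ n) j π) → IsMaximal P j
  insert-linearExtension⇒maximal {j} {π} L k j≺k =
    fromℕ≮ (≡.subst (Fin._< (insert (fromℕ n) j π ⟨$⟩ˡ k))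
      (insert⁻¹-at (fromℕ n) j π) (L j k j≺k))

  -- The other letters keep their relative order, as `punchIn (fromℕ n)` preserves and reflects `<`.
  -- A relation `k ≺ j` is respected because `j` comes last, and maximality excludes `j ≺ l`.
  insert-linearExtension : ∀ {j} π → IsMaximal P j →
    IsLinearExtension P (insert (fromℕ n) j π) ⇔ IsLinearExtension (P ∖ j) π
  insert-linearExtension {j} π j-max = mk⇔ to from
    where
    to : IsLinearExtension P (insert (fromℕ n) j π) → IsLinearExtension (P ∖ j) π
    to L k l k≺l = punchIn-cancel-< (fromℕ n) (≡.subst₂ Fin._<_
      (insert⁻¹-punchIn (fromℕ n) j π k) (insert⁻¹-punchIn (fromℕ n) j π l)
      (L _ _ (∖-≺⁻ j k≺l)))

    from : IsLinearExtension (P ∖ j) π → IsLinearExtension P (insert (fromℕ n) j π)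
    from L k l k≺l with punchInView j k | punchInView j l
    ... | hole       | _          = contradiction k≺l (j-max l)
    ... | punched k′ | hole       = ≡.subst₂ Fin._<_
      (≡.sym (insert⁻¹-punchIn (fromℕ n) j π k′)) (≡.sym (insert⁻¹-at (fromℕ n) j π))
      (punchIn<fromℕ (π ⟨$⟩ˡ k′))
    ... | punched k′ | punched l′ = ≡.subst₂ Fin._<_
      (≡.sym (insert⁻¹-punchIn (fromℕ n) j π k′)) (≡.sym (insert⁻¹-punchIn (fromℕ n) j π l′))
      (punchIn-mono-< (fromℕ n) (L k′ l′ (∖-≺⁺ j k≺l)))

-- Reciprocals and conditional sums.

module _ {c ℓ₁ ℓ₂ ℓ₃} (F : OrderedField c ℓ₁ ℓ₂ ℓ₃) where
  open FieldOperations F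
  open Weights F
  open OrderedField F using (_<_; <-isStrictPartialOrder; commutativeRing)
  open CommutativeRing commutativeRing hiding (zero; refl)
  open CommutativeRing commutativeRing using () renaming (refl to ≈-refl)
  private
    module ∑ₚ = Sum +-commutativeMonoid
    -- Here `sum` is taken in the multiplicative monoid, so lemmas named after sums speak of
    -- products.
    module ∏ₚ = Sum *-commutativeMonoid
    module *ₚ = CommutativeSemigroupProperties *-commutativeSemigroup
    module SR = SemiringSum semiring
  open import Relation.Binary.Reasoning.Setoid (CommutativeRing.setoid commutativeRing)

  infix 9 1/_[_]
  1/_[_] : ∀ b → 0# < b → Carrier
  1/ b [ b>0 ] = 1# / b [ b>0 ]

  /≈*1/ : ∀ a {b} (b>0 : 0# < b) → a / b [ b>0 ] ≈ a * 1/ b [ b>0 ]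
  /≈*1/ a b>0 = *-congˡ (sym (*-identityˡ _))

  1/-inverseʳ : ∀ {b} (b>0 : 0# < b) → b * 1/ b [ b>0 ] ≈ 1#
  1/-inverseʳ b>0 = trans (*-comm _ _) (/-correct 1# _ b>0)

  -- Uniqueness of inverses; in particular the choice of positivity proof does not matter.
  1/-cong : ∀ {b d} (b>0 : 0# < b) (d>0 : 0# < d) → b ≈ d → 1/ b [ b>0 ] ≈ 1/ d [ d>0 ]
  1/-cong {b} {d} b>0 d>0 b≈d = begin
    1/ b [ b>0 ]                       ≈⟨ *-identityʳ _ ⟨
    1/ b [ b>0 ] * 1#                  ≈⟨ *-congˡ (1/-inverseʳ d>0) ⟨
    1/ b [ b>0 ] * (d * 1/ d [ d>0 ])  ≈⟨ *-assoc _ _ _ ⟨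
    1/ b [ b>0 ] * d * 1/ d [ d>0 ]    ≈⟨ *-congʳ (*-congˡ b≈d) ⟨
    1/ b [ b>0 ] * b * 1/ d [ d>0 ]    ≈⟨ *-congʳ (/-correct 1# b b>0) ⟩
    1# * 1/ d [ d>0 ]                  ≈⟨ *-identityˡ _ ⟩
    1/ d [ d>0 ]                       ∎

  infix 5 _when_
  -- The same conditional as in `∑-over`, whose summands are therefore `when` terms by definition.
  _when_ : Carrier → Bool → Carrier
  a when b = if b then a else 0#

  when-congˡ : ∀ {a b} t → a ≈ b → a when t ≈ b when t
  when-congˡ true  a≈b = a≈b
  when-congˡ false a≈b = ≈-refl

  when-both : ∀ {p q} {P : Set p} {Q : Set q} {a} (P? : Dec P) (Q? : Dec Q) →
              (P → ¬ Q) → (a when does P?) when does Q? ≈ 0#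
  when-both (yes p) (yes q) P→¬Q = contradiction q (P→¬Q p)
  when-both (no  _) (yes _) P→¬Q = ≈-refl
  when-both _       (no  _) P→¬Q = ≈-refl

  *-distribˡ-when : ∀ a b t → (a * b) when t ≈ a * (b when t)
  *-distribˡ-when a b true  = ≈-refl
  *-distribˡ-when a b false = sym (zeroʳ a)

  ∑-zero : ∀ {n} (f : Fin n → Carrier) → (∀ i → f i ≈ 0#) → ∑ f ≈ 0#
  ∑-zero {n} f f≈0 = trans (∑ₚ.sum-cong-≋ f≈0) (∑ₚ.sum-replicate-zero n)

  ∑-only : ∀ {n} (f : Fin n → Carrier) i → (∀ j → i ≢ j → f j ≈ 0#) → ∑ f ≈ f i
  ∑-only {suc n} f i f≈0 = begin
    ∑ f                      ≈⟨ ∑ₚ.sum-remove {i = i} f ⟩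
    f i + ∑ (f ∘ punchIn i)  ≈⟨ +-congˡ (∑-zero (f ∘ punchIn i) λ j → f≈0 _ (Finₚ.punchInᵢ≢i i j ∘ ≡.sym)) ⟩
    f i + 0#                 ≈⟨ +-identityʳ _ ⟩
    f i                      ∎

  ∑-when : ∀ {n} (f : Fin n → Carrier) t → ∑ f when t ≈ ∑ λ k → f k when t
  ∑-when f true  = ≈-refl
  ∑-when f false = sym (∑-zero (λ k → f k when false) λ _ → ≈-refl)

  ∑-over-cong : ∀ {n p q} {P : Pred (Fin n) p} {Q : Pred (Fin n) q}
                (P? : Decidable P) (Q? : Decidable Q) → (∀ i → P i ⇔ Q i) →
                ∀ {f g} → (∀ i → f i ≈ g i) → ∑-over P? f ≈ ∑-over Q? g
  ∑-over-cong P? Q? P⇔Q f≈g = ∑ₚ.sum-cong-≋ λ i →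
    trans (when-congˡ _ (f≈g i)) (reflexive (≡.cong (_ when_) (does-⇔ (P⇔Q i) (P? i) (Q? i))))

  ∑-over-remove : ∀ {n p} {P : Pred (Fin (suc n)) p} (P? : Decidable P) f j → ¬ P j →
                  ∑-over P? f ≈ ∑-over (P? ∘ punchIn j) (f ∘ punchIn j)
  ∑-over-remove P? f j ¬Pj = begin
    ∑-over P? f
      ≈⟨ ∑ₚ.sum-remove {i = j} (λ k → f k when does (P? k)) ⟩
    (f j when does (P? j)) + ∑-over (P? ∘ punchIn j) (f ∘ punchIn j)
      ≡⟨ ≡.cong (λ t → (f j when t) + ∑-over (P? ∘ punchIn j) (f ∘ punchIn j)) (dec-false (P? j) ¬Pj) ⟩
    0# + ∑-over (P? ∘ punchIn j) (f ∘ punchIn j)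
      ≈⟨ +-identityˡ _ ⟩
    ∑-over (P? ∘ punchIn j) (f ∘ punchIn j) ∎

  -- Sums over lists.

  ∑ᴸ-cong : ∀ {A : Set a} {f g : A → Carrier} → (∀ y → f y ≈ g y) →
            ∀ ys → ∑ᴸ (map f ys) ≈ ∑ᴸ (map g ys)
  ∑ᴸ-cong f≈g []       = ≈-refl
  ∑ᴸ-cong f≈g (y ∷ ys) = +-cong (f≈g y) (∑ᴸ-cong f≈g ys)

  *-distribˡ-∑ᴸ : ∀ {A : Set a} b (f : A → Carrier) ys →
                  b * ∑ᴸ (map f ys) ≈ ∑ᴸ (map (λ y → b * f y) ys)
  *-distribˡ-∑ᴸ b f []       = zeroʳ b
  *-distribˡ-∑ᴸ b f (y ∷ ys) = trans (distribˡ b _ _) (+-congˡ (*-distribˡ-∑ᴸ b f ys))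

  ∑ᴸ-zero : ∀ {A : Set a} {f : A → Carrier} → (∀ y → f y ≈ 0#) → ∀ ys → ∑ᴸ (map f ys) ≈ 0#
  ∑ᴸ-zero f≈0 []       = ≈-refl
  ∑ᴸ-zero f≈0 (y ∷ ys) = trans (+-cong (f≈0 y) (∑ᴸ-zero f≈0 ys)) (+-identityˡ 0#)

  -- Trades `linearExtensions` for all `permutations`, whose list has a recursive product structure.
  ∑ᴸ-filter : ∀ {A : Set a} {P : Pred A ℓ} (P? : Decidable P) (f : A → Carrier) ys →
              ∑ᴸ (map f (filter P? ys)) ≈ ∑ᴸ (map (λ y → f y when does (P? y)) ys)
  ∑ᴸ-filter P? f []       = ≈-refl
  ∑ᴸ-filter P? f (y ∷ ys) with does (P? y)
  ... | true  = +-congˡ (∑ᴸ-filter P? f ys)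
  ... | false = trans (∑ᴸ-filter P? f ys) (sym (+-identityˡ _))

  ∑ᴸ-++ : ∀ {A : Set a} (f : A → Carrier) ys zs →
          ∑ᴸ (map f (ys ++ zs)) ≈ ∑ᴸ (map f ys) + ∑ᴸ (map f zs)
  ∑ᴸ-++ f []       zs = sym (+-identityˡ _)
  ∑ᴸ-++ f (y ∷ ys) zs = trans (+-congˡ (∑ᴸ-++ f ys zs)) (sym (+-assoc _ _ _))

  -- Splits a sum over `permutations (suc n)` by last letter. The function `h` is arbitrary because
  -- the induction passes from `h` to `h ∘ suc`.
  ∑ᴸ-cartesianProductWith-tabulate : ∀ {a b c n} {A : Set a} {B : Set b} {C : Set c}
    (f : C → Carrier) (_·_ : A → B → C) (h : Fin n → A) zs →
    ∑ᴸ (map f (cartesianProductWith _·_ (tabulate h) zs)) ≈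
    ∑ λ i → ∑ᴸ (map (λ z → f (h i · z)) zs)
  ∑ᴸ-cartesianProductWith-tabulate {n = zero}  f _·_ h zs = ≈-refl
  ∑ᴸ-cartesianProductWith-tabulate {n = suc n} f _·_ h zs = trans
    (∑ᴸ-++ f (map (h zero ·_) zs) _)
    (+-cong (reflexive (≡.cong ∑ᴸ (≡.sym (map-∘ zs))))
            (∑ᴸ-cartesianProductWith-tabulate f _·_ (h ∘ suc) zs))

  -- Prefix sums of a word with prescribed last letter.

  prefixSum-last : ∀ (y : Fin (suc n) → Carrier) → prefixSum y (fromℕ n) ≈ ∑ y
  prefixSum-last {n} y = ∑ₚ.sum-cong-≋ λ i →
    reflexive (≡.cong (y i when_) (dec-true (i Finₚ.≤? fromℕ n) (Finₚ.≤fromℕ i)))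

  -- The full prefix contains each letter once, so the total is the same for all `j` and `π`.
  prefixSum-insert-last : ∀ (x : Fin (suc n) → Carrier) j (π : Permutation′ n) →
    prefixSum (x ∘ (insert (fromℕ n) j π ⟨$⟩ʳ_)) (fromℕ n) ≈ ∑ x
  prefixSum-insert-last {n} x j π =
    trans (prefixSum-last (x ∘ (insert (fromℕ n) j π ⟨$⟩ʳ_)))
          (sym (∑ₚ.sum-permute x (insert (fromℕ n) j π)))

  -- A shorter prefix misses position `fromℕ n`; on the other positions `insert` gives `π` with
  -- letters renumbered by `punchIn j`.
  prefixSum-insert-init : ∀ (x : Fin (suc n) → Carrier) j (π : Permutation′ n) i →
    prefixSum (x ∘ (insert (fromℕ n) j π ⟨$⟩ʳ_)) (punchIn (fromℕ n) i) ≈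
    prefixSum (x ∘ punchIn j ∘ (π ⟨$⟩ʳ_)) i
  prefixSum-insert-init {n} x j π i = trans
    (∑-over-remove (Finₚ._≤? punchIn (fromℕ n) i) (x ∘ (insert (fromℕ n) j π ⟨$⟩ʳ_)) (fromℕ n)
      (ℕₚ.<⇒≱ (punchIn<fromℕ i)))
    (∑-over-cong ((Finₚ._≤? punchIn (fromℕ n) i) ∘ punchIn (fromℕ n)) (Finₚ._≤? i)
      (λ k → mk⇔ (Finₚ.punchIn-cancel-≤ (fromℕ n) k i) (Finₚ.punchIn-mono-≤ (fromℕ n) k i))
      (λ k → reflexive (≡.cong x (insert-punchIn (fromℕ n) j π k))))

  -- This is `w π` stripped of its numerators, which do not depend on `π`.
  reciprocalPrefixSums : (x : Fin n → Carrier) → (∀ i → 0# < x i) → Permutation′ n → Carrier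
  reciprocalPrefixSums x x>0 π =
    ∏ λ i → 1/ prefixSum (x ∘ (π ⟨$⟩ʳ_)) i [ prefixSum-pos (x>0 ∘ (π ⟨$⟩ʳ_)) i ]

  reciprocalPrefixSums-insert : ∀ (x : Fin (suc n) → Carrier) x>0 (∑x>0 : 0# < ∑ x) j π →
    reciprocalPrefixSums x x>0 (insert (fromℕ n) j π) ≈
    1/ ∑ x [ ∑x>0 ] * reciprocalPrefixSums (x ∘ punchIn j) (x>0 ∘ punchIn j) π
  reciprocalPrefixSums-insert {n} x x>0 ∑x>0 j π = trans
    (∏ₚ.sum-remove {i = fromℕ n} (λ i → 1/ prefixSum (x ∘ (σ ⟨$⟩ʳ_)) i [ σ>0 i ]))
    (*-cong (1/-cong (σ>0 (fromℕ n)) ∑x>0 (prefixSum-insert-last x j π))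
            (∏ₚ.sum-cong-≋ λ i → 1/-cong (σ>0 (punchIn (fromℕ n) i))
              (prefixSum-pos (x>0 ∘ punchIn j ∘ (π ⟨$⟩ʳ_)) i)
              (prefixSum-insert-init x j π i)))
    where
    σ : Permutation′ (suc n)
    σ = insert (fromℕ n) j π

    σ>0 : ∀ i → 0# < prefixSum (x ∘ (σ ⟨$⟩ʳ_)) i
    σ>0 = prefixSum-pos (x>0 ∘ (σ ⟨$⟩ʳ_))

  -- Hooks and the weighted hook formula.

  module _ (P : PosetOn n ℓ) (x : Fin n → Carrier) where
    open PosetOn P
    open Poset poset using () renaming (refl to ≼-refl)

    hook : Fin n → Carrier
    hook i = ∑-over (_≼? i) x

    hook-pos : (∀ i → 0# < x i) → ∀ i → 0# < hook i
    hook-pos x>0 i = ∑-over-pos (_≼? i) x>0 (≼-refl {i})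

    -- Each x k is counted once, at the root of the tree containing k.
    ∑-maximal-hook : UpSetsAreChains P → ∑-over (isMaximal? P) hook ≈ ∑ x
    ∑-maximal-hook chains = begin
      ∑ (λ r → hook r when does (isMaximal? P r))
        ≈⟨ ∑ₚ.sum-cong-≋ (λ r →
             ∑-when (λ k → x k when does (k ≼? r)) (does (isMaximal? P r))) ⟩
      ∑ (λ r → ∑ λ k → term k r)
        ≈⟨ ∑ₚ.∑-comm (flip term) ⟩
      ∑ (λ k → ∑ λ r → term k r)
        ≈⟨ ∑ₚ.sum-cong-≋ ∑-term ⟩
      ∑ x ∎
      where
      term : Fin n → Fin n → Carrier
      term k r = (x k when does (k ≼? r)) when does (isMaximal? P r)

      ∑-term : ∀ k → ∑ (term k) ≈ x k
      ∑-term k with r , k≼r , r-max ← maximalAbove P k = trans (∑-only (term k) r others) this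
        where
        this : term k r ≈ x k
        this rewrite dec-true (k ≼? r) k≼r | dec-true (isMaximal? P r) r-max = ≈-refl

        others : ∀ s → r ≢ s → term k s ≈ 0#
        others s r≢s = when-both (k ≼? s) (isMaximal? P s)
          λ k≼s s-max → r≢s (maximalAbove-unique P chains k≼r r-max k≼s s-max)

  -- A maximal `j` lies below no other element, so its weight enters no hook but its own.
  hook-∖ : ∀ (P : PosetOn (suc n) ℓ) x {j} → IsMaximal P j → ∀ i →
           hook P x (punchIn j i) ≈ hook (P ∖ j) (x ∘ punchIn j) i
  hook-∖ P x {j} j-max i = ∑-over-remove (_≼? punchIn j i) x j
    λ j≼i → j-max (punchIn j i) (j≼i , Finₚ.punchInᵢ≢i j i ∘ ≡.sym)
    where open PosetOn P

  reciprocalHooks : (P : PosetOn n ℓ) (x : Fin n → Carrier) → (∀ i → 0# < x i) → Carrier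
  reciprocalHooks P x x>0 = ∏ λ i → 1/ hook P x i [ hook-pos P x x>0 i ]

  -- The factors away from `j` survive the deletion, and `hook P x j` cancels the factor at `j`.
  reciprocalHooks-∖ : ∀ (P : PosetOn (suc n) ℓ) x x>0 {j} → IsMaximal P j →
    reciprocalHooks (P ∖ j) (x ∘ punchIn j) (x>0 ∘ punchIn j) ≈
    hook P x j * reciprocalHooks P x x>0
  reciprocalHooks-∖ {n = n} P x x>0 {j} j-max = begin
    reciprocalHooks (P ∖ j) (x ∘ punchIn j) (x>0 ∘ punchIn j)
      ≈⟨ ∏ₚ.sum-cong-≋ (λ i → 1/-cong (hook-pos P x x>0 (punchIn j i))
           (hook-pos (P ∖ j) (x ∘ punchIn j) (x>0 ∘ punchIn j) i) (hook-∖ P x j-max i)) ⟨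
    ∏ (reciprocal ∘ punchIn j)
      ≈⟨ *-identityˡ _ ⟨
    1# * ∏ (reciprocal ∘ punchIn j)
      ≈⟨ *-congʳ (1/-inverseʳ (hook-pos P x x>0 j)) ⟨
    hook P x j * reciprocal j * ∏ (reciprocal ∘ punchIn j)
      ≈⟨ *-assoc _ _ _ ⟩
    hook P x j * (reciprocal j * ∏ (reciprocal ∘ punchIn j))
      ≈⟨ *-congˡ (∏ₚ.sum-remove {i = j} reciprocal) ⟨
    hook P x j * reciprocalHooks P x x>0 ∎
    where
    reciprocal : Fin (suc n) → Carrier
    reciprocal i = 1/ hook P x i [ hook-pos P x x>0 i ]

  -- Chains and arbitrary positive weights make the statement inductive: the step replaces `P` by
  -- `P ∖ j` and `x` by `x ∘ punchIn j`.
  ∑-reciprocalPrefixSums : ∀ (P : PosetOn n ℓ) → UpSetsAreChains P →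
    (x : Fin n → Carrier) (x>0 : ∀ i → 0# < x i) →
    ∑ᴸ (map (reciprocalPrefixSums x x>0) (PosetOn.linearExtensions P)) ≈ reciprocalHooks P x x>0
  -- The empty word is the only linear extension and both products are empty, so the left side is
  -- `1# + 0#`.
  ∑-reciprocalPrefixSums {n = zero}  P chains x x>0 = +-identityʳ 1#
  ∑-reciprocalPrefixSums {n = suc n} P chains x x>0 = begin
    ∑ᴸ (map W (linearExtensions P))
      ≈⟨ ∑ᴸ-filter (isLinearExtension? P) W (permutations (suc n)) ⟩
    ∑ᴸ (map summand (permutations (suc n)))
      ≈⟨ ∑ᴸ-cartesianProductWith-tabulate _ (insert (fromℕ n)) (λ j → j) (permutations n) ⟩
    ∑ (λ j → ∑ᴸ (map (summand ∘ insert (fromℕ n) j) (permutations n)))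
      ≈⟨ ∑ₚ.sum-cong-≋ (λ j → lastLetter j (isMaximal? P j)) ⟩
    ∑ (λ j → (hook P x j when does (isMaximal? P j)) * (1/X * H))
      ≈⟨ SR.*-distribʳ-sum (1/X * H) (λ j → hook P x j when does (isMaximal? P j)) ⟨
    ∑-over (isMaximal? P) (hook P x) * (1/X * H)
      ≈⟨ *-congʳ (∑-maximal-hook P x chains) ⟩
    ∑ x * (1/X * H)
      ≈⟨ *-assoc _ _ _ ⟨
    ∑ x * 1/X * H
      ≈⟨ *-congʳ (1/-inverseʳ X>0) ⟩
    1# * H
      ≈⟨ *-identityˡ H ⟩
    H ∎
    where
    open PosetOn using (linearExtensions; isLinearExtension?)

    W : Permutation′ (suc n) → Carrier
    W = reciprocalPrefixSums x x>0

    H : Carrier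
    H = reciprocalHooks P x x>0

    X>0 : 0# < ∑ x
    X>0 = IsStrictPartialOrder.<-respʳ-≈ <-isStrictPartialOrder
      (prefixSum-last x) (prefixSum-pos x>0 (fromℕ n))

    1/X : Carrier
    1/X = 1/ ∑ x [ X>0 ]

    summand : Permutation′ (suc n) → Carrier
    summand π = W π when does (isLinearExtension? P π)

    -- The decision is an argument so that matching on it reduces the `when`. A letter that is not
    -- maximal ends no linear extension and contributes zero.
    lastLetter : ∀ j (j-max? : Dec (IsMaximal P j)) →
      ∑ᴸ (map (summand ∘ insert (fromℕ n) j) (permutations n)) ≈
      (hook P x j when does j-max?) * (1/X * H)
    lastLetter j (no ¬j-max) = trans
      (∑ᴸ-zero (λ π → reflexive (≡.cong (W (insert (fromℕ n) j π) when_)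
        (dec-false (isLinearExtension? P (insert (fromℕ n) j π))
          (¬j-max ∘ insert-linearExtension⇒maximal P {π = π})))) (permutations n))
      (sym (zeroˡ _))
    lastLetter j (yes j-max) = begin
      ∑ᴸ (map (summand ∘ insert (fromℕ n) j) (permutations n))
        -- The test for `P` becomes the test for `P ∖ j`, and the factor `1/X` of the last position
        -- moves out of the `when`.
        ≈⟨ ∑ᴸ-cong (λ π → trans
             (reflexive (≡.cong (W (insert (fromℕ n) j π) when_)
               (does-⇔ (insert-linearExtension P π j-max)
                 (isLinearExtension? P (insert (fromℕ n) j π)) (isLinearExtension? (P ∖ j) π))))
             (trans (when-congˡ _ (reciprocalPrefixSums-insert x x>0 X>0 j π))
                    (*-distribˡ-when _ _ _)))
             (permutations n) ⟩
      ∑ᴸ (map (λ π → 1/X * (W′ π when does (isLinearExtension? (P ∖ j) π))) (permutations n))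
        ≈⟨ *-distribˡ-∑ᴸ 1/X _ (permutations n) ⟨
      1/X * ∑ᴸ (map (λ π → W′ π when does (isLinearExtension? (P ∖ j) π)) (permutations n))
        ≈⟨ *-congˡ (∑ᴸ-filter (isLinearExtension? (P ∖ j)) W′ (permutations n)) ⟨
      1/X * ∑ᴸ (map W′ (linearExtensions (P ∖ j)))
        -- The order of `P ∖ j` unfolds to that of `P` at `punchIn j`, so `chains` applies as it
        -- stands.
        ≈⟨ *-congˡ (∑-reciprocalPrefixSums (P ∖ j) chains (x ∘ punchIn j) (x>0 ∘ punchIn j)) ⟩
      1/X * reciprocalHooks (P ∖ j) (x ∘ punchIn j) (x>0 ∘ punchIn j)
        ≈⟨ *-congˡ (reciprocalHooks-∖ P x x>0 j-max) ⟩
      1/X * (hook P x j * H)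
        ≈⟨ *ₚ.x∙yz≈y∙xz _ _ _ ⟩
      hook P x j * (1/X * H) ∎
      where
      W′ : Permutation′ n → Carrier
      W′ = reciprocalPrefixSums (x ∘ punchIn j) (x>0 ∘ punchIn j)

  -- From the hook formula back to `Z` and `w`.

  Z*w : ∀ (P : PosetOn n ℓ) x x>0 π →
        Z x x>0 P * w x x>0 π ≈ ∏ (hook P x) * reciprocalPrefixSums x x>0 π
  Z*w {n = n} P x x>0 π = begin
    Z x x>0 P * w x x>0 π
      ≈⟨ ∏ₚ.∑-distrib-+ {n} _ _ ⟨
    ∏ (λ i → (hook P x i / prefixSum x i [ prefixSum-pos x>0 i ]) *
             (prefixSum x i / prefixSum (x ∘ (π ⟨$⟩ʳ_)) i [ prefixSum-pos (x>0 ∘ (π ⟨$⟩ʳ_)) i ]))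
      -- At each index, `prefixSum x i` is the denominator in `Z` and the numerator in `w`.
      ≈⟨ ∏ₚ.sum-cong-≋ (λ i → trans (*-congˡ (/≈*1/ _ _))
           (trans (sym (*-assoc _ _ _)) (*-congʳ (/-correct _ _ (prefixSum-pos x>0 i))))) ⟩
    ∏ (λ i → hook P x i * 1/ prefixSum (x ∘ (π ⟨$⟩ʳ_)) i [ prefixSum-pos (x>0 ∘ (π ⟨$⟩ʳ_)) i ])
      ≈⟨ ∏ₚ.∑-distrib-+ (hook P x) _ ⟩
    ∏ (hook P x) * reciprocalPrefixSums x x>0 π ∎

  ∏hook*reciprocalHooks : ∀ (P : PosetOn n ℓ) x x>0 → ∏ (hook P x) * reciprocalHooks P x x>0 ≈ 1#
  ∏hook*reciprocalHooks {n = n} P x x>0 = begin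
    ∏ (hook P x) * reciprocalHooks P x x>0
      ≈⟨ ∏ₚ.∑-distrib-+ {n} _ _ ⟨
    ∏ (λ i → hook P x i * 1/ hook P x i [ hook-pos P x x>0 i ])
      ≈⟨ ∏ₚ.sum-cong-≋ (λ i → 1/-inverseʳ (hook-pos P x x>0 i)) ⟩
    ∏ {n} (λ _ → 1#)
      ≈⟨ ∏ₚ.sum-replicate-zero n ⟩
    1# ∎

theorem5p1 : ∀ {c ℓ₁ ℓ₂ ℓ₃ ℓ} (F : OrderedField c ℓ₁ ℓ₂ ℓ₃) (n : ℕ) (P : PosetOn n ℓ) →
    IsRootedForest (PosetOn.poset P) →
    PosetOn.IsNatural P →
    (x : Fin n → OrderedField.Carrier F) →
    (x>0 : ∀ i → OrderedField._<_ F (OrderedField.0# F) (x i)) →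
    OrderedField._≈_ F
    (FieldOperations.∑ᴸ F
    (map (λ π → OrderedField._*_ F (Weights.Z F x x>0 P) (Weights.w F x x>0 π))
    (PosetOn.linearExtensions P)))
    (OrderedField.1# F)
theorem5p1 F n P forest _ x x>0 = begin
  ∑ᴸ (map (λ π → Z x x>0 P * w x x>0 π) (linearExtensions P))
    ≈⟨ ∑ᴸ-cong F (Z*w F P x x>0) (linearExtensions P) ⟩
  ∑ᴸ (map (λ π → ∏ (hook F P x) * reciprocalPrefixSums F x x>0 π) (linearExtensions P))
    -- The product of hooks is the same for every `π`, so it leaves the sum.
    ≈⟨ *-distribˡ-∑ᴸ F _ _ (linearExtensions P) ⟨
  ∏ (hook F P x) * ∑ᴸ (map (reciprocalPrefixSums F x x>0) (linearExtensions P))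
    ≈⟨ *-congˡ (∑-reciprocalPrefixSums F P (rootedForest⇒upSetsAreChains P forest) x x>0) ⟩
  ∏ (hook F P x) * reciprocalHooks F P x x>0
    ≈⟨ ∏hook*reciprocalHooks F P x x>0 ⟩
  1# ∎
  where
  open FieldOperations F
  open Weights F
  open PosetOn using (linearExtensions)
  open CommutativeRing (OrderedField.commutativeRing F) using (_*_; 1#; *-congˡ; setoid)
  open import Relation.Binary.Reasoning.Setoid setoid
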